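{- The variety of subresiduated semilattices is exactly the class of $\{\to,\wedge\}$-subreducts of subresiduated lattices (viewed as algebras $(A,\wedge,\to,1)$ of type $(2,2,0)$).
   Context: A subresiduated semilattice is an algebra $(A,\wedge,\to,1)$ of type $(2,2,0)$ such that $(A,\wedge)$ is a meet-semilattice with greatest element $1$ (with associated order $\le$) and for all $x,y,z\in A$: (SR1) $(x\wedge y)\to y=1$; (SR2) $x\to y\le z\to(x\to y)$; (SR3) $x\wedge(x\to y)\le y$; (SR4) $z\to(x\wedge y)=(z\to x)\wedge(z\to y)$. A subresiduated lattice is an algebra $(A,\wedge,\vee,\to,0,1)$ of type $(2,2,2,0,0)$ such that $(A,\wedge,\vee,0,1)$ is a bounded distributive lattice and for all $x,y,z\in A$: $x\to x=1$; $x\to y\le z\to(x\to y)$; $x\wedge(x\to y)\le y$; $z\to(x\wedge y)=(z\to x)\wedge(z\to y)$; $(x\vee y)\to z=(x\to z)\wedge(y\to z)$; $(x\to y)\wedge(y\to z)\le x\to z$. A $\{\to,\wedge\}$-subreduct of a subresiduated lattice $A$ is any isomorphic image of a (nonempty) subalgebra of the reduct $(A,\wedge,\to)$; since $1=x\to x$, such a subalgebra contains $1$ and is viewed as an algebra of type $(2,2,0)$. -}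

module Defs where

open import Level using (Level; _⊔_; suc)
open import Algebra.Core using (Op₂)
open import Algebra.Definitions using (Congruent₂; _DistributesOverˡ_)
open import Algebra.Lattice.Structures
  using (IsBoundedMeetSemilattice; IsDistributiveLattice)
open import Algebra.Morphism.Definitions using (Homomorphic₀; Homomorphic₂)
open import Data.Product.Base using (Σ; ∃; _,_; proj₁; proj₂)
open import Function.Definitions using (Congruent; Bijective)
open import Relation.Binary.Core using (Rel)
open import Relation.Binary.Definitions using (Maximum; Minimum; _Respects_)
open import Relation.Binary.Structures using (IsEquivalence)
open import Relation.Unary using (Pred; _∈_)
import Relation.Binary.Construct.NaturalOrder.Left as NaturalOrder

-- As in the standard library, the equality of an algebra is a setoid
-- equality respected by the operations.

-- Arbitrary algebras (A , ∧ , → , 1) of type (2 , 2 , 0), no laws imposed.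
record Algebra₂₂₀ (c ℓ : Level) : Set (suc (c ⊔ ℓ)) where
  infix  4 _≈_
  infixr 7 _∧_
  infixr 5 _⇒_
  field
    Carrier       : Set c
    _≈_           : Rel Carrier ℓ
    _∧_           : Op₂ Carrier
    _⇒_           : Op₂ Carrier
    ⊤             : Carrier
    isEquivalence : IsEquivalence _≈_
    ∧-cong        : Congruent₂ _≈_ _∧_
    ⇒-cong        : Congruent₂ _≈_ _⇒_

  -- x ≤ y  is  x ≈ x ∧ y
  open NaturalOrder _≈_ _∧_ public using (_≤_)

record IsSubresiduatedSemilattice {c ℓ} (A : Algebra₂₂₀ c ℓ) : Set (c ⊔ ℓ) where
  open Algebra₂₂₀ A
  field
    -- ⊤ being an identity of ∧ says exactly that it is the greatest element.
    isBoundedMeetSemilattice : IsBoundedMeetSemilattice _≈_ _∧_ ⊤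
    SR1 : ∀ x y → (x ∧ y) ⇒ y ≈ ⊤
    SR2 : ∀ x y z → x ⇒ y ≤ z ⇒ (x ⇒ y)
    SR3 : ∀ x y → x ∧ (x ⇒ y) ≤ y
    SR4 : _DistributesOverˡ_ _≈_ _⇒_ _∧_

record SubresiduatedLattice (c ℓ : Level) : Set (suc (c ⊔ ℓ)) where
  infix  4 _≈_
  infixr 7 _∧_
  infixr 6 _∨_
  infixr 5 _⇒_
  field
    Carrier : Set c
    _≈_     : Rel Carrier ℓ
    _∧_     : Op₂ Carrier
    _∨_     : Op₂ Carrier
    _⇒_     : Op₂ Carrier
    ⊥       : Carrier
    ⊤       : Carrier

  open NaturalOrder _≈_ _∧_ public using (_≤_)

  field
    isDistributiveLattice : IsDistributiveLattice _≈_ _∨_ _∧_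
    minimum      : Minimum _≤_ ⊥
    maximum      : Maximum _≤_ ⊤
    ⇒-cong       : Congruent₂ _≈_ _⇒_
    ⇒-refl       : ∀ x → x ⇒ x ≈ ⊤
    ⇒-weaken     : ∀ x y z → x ⇒ y ≤ z ⇒ (x ⇒ y)
    modusPonens  : ∀ x y → x ∧ (x ⇒ y) ≤ y
    ⇒-distribˡ-∧ : _DistributesOverˡ_ _≈_ _⇒_ _∧_
    ∨-⇒          : ∀ x y z → (x ∨ y) ⇒ z ≈ (x ⇒ z) ∧ (y ⇒ z)
    ⇒-trans      : ∀ x y z → (x ⇒ y) ∧ (y ⇒ z) ≤ x ⇒ z

  open IsDistributiveLattice isDistributiveLattice public
    using (isEquivalence; ∧-cong)

-- Nonempty subuniverses of the reduct (L , ∧ , →).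
record Subuniverse {c ℓ} (L : SubresiduatedLattice c ℓ) (p : Level)
       : Set (c ⊔ ℓ ⊔ suc p) where
  open SubresiduatedLattice L
  field
    Member   : Pred Carrier p
    resp     : Member Respects _≈_
    nonempty : ∃ Member
    ∧-closed : ∀ {x y} → x ∈ Member → y ∈ Member → (x ∧ y) ∈ Member
    ⇒-closed : ∀ {x y} → x ∈ Member → y ∈ Member → (x ⇒ y) ∈ Member

  ⊤-closed : ⊤ ∈ Member
  ⊤-closed = resp (⇒-refl x) (⇒-closed x∈S x∈S)
    where
    x   = proj₁ nonempty
    x∈S = proj₂ nonempty

subalgebra : ∀ {c ℓ p} (L : SubresiduatedLattice c ℓ) →
             Subuniverse L p → Algebra₂₂₀ (c ⊔ p) ℓ
subalgebra L S = record
  { Carrier       = Σ Carrier Member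
  ; _≈_           = λ x y → proj₁ x ≈ proj₁ y
  ; _∧_           = λ (x , x∈S) (y , y∈S) → x ∧ y , ∧-closed x∈S y∈S
  ; _⇒_           = λ (x , x∈S) (y , y∈S) → x ⇒ y , ⇒-closed x∈S y∈S
  ; ⊤             = ⊤ , ⊤-closed
  ; isEquivalence = record { refl = refl ; sym = sym ; trans = trans }
  ; ∧-cong        = ∧-cong
  ; ⇒-cong        = ⇒-cong
  }
  where
  open SubresiduatedLattice L
  open Subuniverse S
  open IsEquivalence isEquivalence

record _≅_ {a ℓ₁ b ℓ₂} (A : Algebra₂₂₀ a ℓ₁) (B : Algebra₂₂₀ b ℓ₂)
       : Set (a ⊔ ℓ₁ ⊔ b ⊔ ℓ₂) where
  private
    module A = Algebra₂₂₀ A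
    module B = Algebra₂₂₀ B
  field
    ⟦_⟧       : A.Carrier → B.Carrier
    cong      : Congruent A._≈_ B._≈_ ⟦_⟧
    bijective : Bijective A._≈_ B._≈_ ⟦_⟧
    ∧-homo    : Homomorphic₂ A.Carrier B.Carrier B._≈_ ⟦_⟧ A._∧_ B._∧_
    ⇒-homo    : Homomorphic₂ A.Carrier B.Carrier B._≈_ ⟦_⟧ A._⇒_ B._⇒_
    ⊤-homo    : Homomorphic₀ A.Carrier B.Carrier B._≈_ ⟦_⟧ A.⊤ B.⊤

infix 4 _≅_ _IsSubreductOf_

_IsSubreductOf_ : ∀ {a ℓ₁ b ℓ₂} →
                  Algebra₂₂₀ a ℓ₁ → SubresiduatedLattice b ℓ₂ →
                  Set (a ⊔ ℓ₁ ⊔ suc (b ⊔ ℓ₂))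
_IsSubreductOf_ {b = b} {ℓ₂ = ℓ₂} A L =
  ∃ λ (S : Subuniverse L (b ⊔ ℓ₂)) → subalgebra L S ≅ A

{-# OPTIONS --safe #-}

-- A subresiduated semilattice A embeds in the distributive lattice of its
-- finitely generated down-sets, a list X of generators standing for ⋁ X.
-- Call an element d open if d ≤ ⊤ ⇒ d. In A, x ⇒ y is the largest open d with
-- d ∧ x ≤ y. Calling a list open when its entries are, and noting that an
-- element of A below ⋁ Y is below some y ∈ Y, the element ⋀ₓ ⋁ᵧ (x ⇒ y) is the
-- largest open D with D ∧ ⋁ X ≤ ⋁ Y; the lattice axioms only use this
-- adjunction and that opens contain ⊤ and are closed under ∧.

module Submission where

open import Defs
open import Level using (Level; _⊔_)
open import Algebra.Lattice.Bundles using (DistributiveLattice; Lattice; Semilattice)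
open import Algebra.Lattice.Structures
  using (IsBoundedMeetSemilattice; IsDistributiveLattice)
open import Algebra.Lattice.Morphism.Structures using (IsLatticeMonomorphism)
import Algebra.Lattice.Morphism.LatticeMonomorphism as LatticeMonomorphism
import Algebra.Lattice.Properties.Lattice as LatticeProperties
import Algebra.Lattice.Properties.Semilattice as SemilatticeProperties
open import Algebra.Morphism.Structures using (IsMonoidMonomorphism)
import Algebra.Morphism.MonoidMonomorphism as MonoidMonomorphism
open import Algebra.Core using (Op₂)
open import Algebra.Structures using (IsCommutativeMonoid)
open import Algebra.Morphism.Definitions using (Homomorphic₀; Homomorphic₂)
open import Data.List.Base using (List; []; _∷_; [_]; _++_; map; foldr; cartesianProductWith)
open import Data.List.Relation.Unary.All as All using (All; []; _∷_)
import Data.List.Relation.Unary.All.Properties as All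
open import Data.List.Relation.Unary.Any as Any using (Any; here; there)
import Data.List.Relation.Unary.Any.Properties as Any
open import Data.Product.Base using (∃; _,_; proj₁; proj₂)
open import Data.Sum.Base using ([_,_]′)
open import Function.Base using (id; _∘_)
open import Function.Bundles using (_⇔_; mk⇔)
open import Function.Definitions using (Congruent; Injective)
open import Relation.Binary.Bundles using (Setoid; module Poset)
open import Relation.Binary.Definitions using (Maximum; Minimum)
import Relation.Binary.Lattice as Order
import Relation.Binary.Lattice.Properties.MeetSemilattice as MeetSemilatticeProperties
open import Relation.Binary.Structures using (IsEquivalence)
import Relation.Binary.Construct.NaturalOrder.Left as NaturalOrder
import Relation.Binary.Reasoning.PartialOrder as ≤-Reasoning
import Relation.Binary.Reasoning.Setoid as ≈-Reasoning
open import Relation.Unary using (Pred; _∈_; _⊆_; _≐_; _∪_; _∩_)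
open import Relation.Unary.Algebra using (∪-∩-isDistributiveLattice)

private variable
  a b c ℓ ℓ₁ ℓ₂ p : Level

-- Subresiduated lattices from largest open elements.

module _ (DL : DistributiveLattice c ℓ) where
  open DistributiveLattice DL
  open NaturalOrder _≈_ _∧_ using (_≤_)
  private
    module LP = LatticeProperties lattice
    open Order.Lattice LP.∨-∧-orderTheoreticLattice
      using (antisym; x∧y≤x; x∧y≤y; ∧-greatest; x≤x∨y; y≤x∨y; ∨-least)
      renaming (poset to ≤-poset; refl to ≤-refl; trans to ≤-trans; reflexive to ≤-reflexive)
    open MeetSemilatticeProperties LP.∧-orderTheoreticMeetSemilattice
      using (∧-monotonic)

  -- To put an element below `x ⇒ y`, it suffices that it is open and that its meet with `x` is
  -- below `y`. Each axiom is then a short computation with `eval`, and distributivity of the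
  -- lattice enters only in `∨-⇒`. Congruence of `_⇒_` is derived from its monotonicity by
  -- antisymmetry.
  largestOpens⇒subresiduatedLattice :
    (⊥ ⊤ : Carrier) → Minimum _≤_ ⊥ → Maximum _≤_ ⊤ →
    (Open : Pred Carrier p) (_⇒_ : Op₂ Carrier) →
    Open ⊤ →
    (∀ {d e} → Open d → Open e → Open (d ∧ e)) →
    (∀ x y → Open (x ⇒ y)) →
    (∀ x y → x ∧ (x ⇒ y) ≤ y) →
    (∀ {d} x y → Open d → x ∧ d ≤ y → d ≤ x ⇒ y) →
    SubresiduatedLattice c ℓ
  largestOpens⇒subresiduatedLattice ⊥ ⊤ ⊥-min ⊤-max Open _⇒_
    ⊤-open ∧-open ⇒-open eval largest = record
    { _≈_ = _≈_ ; _∧_ = _∧_ ; _∨_ = _∨_ ; _⇒_ = _⇒_ ; ⊥ = ⊥ ; ⊤ = ⊤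
    ; isDistributiveLattice = isDistributiveLattice
    ; minimum      = ⊥-min
    ; maximum      = ⊤-max
    ; ⇒-cong       = λ x≈x′ y≈y′ → antisym
        (⇒-mono (≤-reflexive (sym x≈x′)) (≤-reflexive y≈y′))
        (⇒-mono (≤-reflexive x≈x′) (≤-reflexive (sym y≈y′)))
    ; ⇒-refl       = λ x → antisym (⊤-max _) (largest x x ⊤-open (x∧y≤x x ⊤))
    ; ⇒-weaken     = λ x y z → largest z (x ⇒ y) (⇒-open x y) (x∧y≤y z _)
    ; modusPonens  = eval
    ; ⇒-distribˡ-∧ = λ z x y → antisym
        (∧-greatest (⇒-mono ≤-refl (x∧y≤x x y)) (⇒-mono ≤-refl (x∧y≤y x y)))
        (largest z (x ∧ y) (∧-open (⇒-open z x) (⇒-open z y)) (∧-greatest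
          (≤-trans (∧-monotonic ≤-refl (x∧y≤x _ _)) (eval z x))
          (≤-trans (∧-monotonic ≤-refl (x∧y≤y _ _)) (eval z y))))
    ; ∨-⇒          = λ x y z → antisym
        (∧-greatest (⇒-mono (x≤x∨y x y) ≤-refl) (⇒-mono (y≤x∨y x y) ≤-refl))
        (largest (x ∨ y) z (∧-open (⇒-open x z) (⇒-open y z))
          (≤-trans (≤-reflexive (∧-distribʳ-∨ _ x y)) (∨-least
            (≤-trans (∧-monotonic ≤-refl (x∧y≤x _ _)) (eval x z))
            (≤-trans (∧-monotonic ≤-refl (x∧y≤y _ _)) (eval y z)))))
    ; ⇒-trans      = λ x y z → largest x z (∧-open (⇒-open x y) (⇒-open y z))
        (≤-trans
          (∧-greatest
            (≤-trans (∧-monotonic ≤-refl (x∧y≤x _ _)) (eval x y))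
            (≤-trans (x∧y≤y x _) (x∧y≤y _ _)))
          (eval y z))
    }
    where
    ⇒-mono : ∀ {x x′ y y′} → x′ ≤ x → y ≤ y′ → x ⇒ y ≤ x′ ⇒ y′
    ⇒-mono {x} {x′} {y} {y′} x′≤x y≤y′ = largest x′ y′ (⇒-open x y)
      (≤-trans (∧-monotonic x′≤x ≤-refl) (≤-trans (eval x y) y≤y′))

-- Subreducts as embeddings.

record Embedding (A : Algebra₂₂₀ a ℓ₁) (L : SubresiduatedLattice b ℓ₂)
       : Set (a ⊔ ℓ₁ ⊔ b ⊔ ℓ₂) where
  private
    module A = Algebra₂₂₀ A
    module L = SubresiduatedLattice L
  field
    ⟦_⟧       : A.Carrier → L.Carrier
    cong      : Congruent A._≈_ L._≈_ ⟦_⟧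
    injective : Injective A._≈_ L._≈_ ⟦_⟧
    ∧-homo    : Homomorphic₂ A.Carrier L.Carrier L._≈_ ⟦_⟧ A._∧_ L._∧_
    ⇒-homo    : Homomorphic₂ A.Carrier L.Carrier L._≈_ ⟦_⟧ A._⇒_ L._⇒_
    ⊤-homo    : Homomorphic₀ A.Carrier L.Carrier L._≈_ ⟦_⟧ A.⊤ L.⊤

-- The embedding is the inverse of the isomorphism, read off from surjectivity, followed by
-- inclusion. Its laws are checked in `A` after applying the isomorphism, which is injective.
subreduct⇒embedding : {A : Algebra₂₂₀ a ℓ₁} {L : SubresiduatedLattice b ℓ₂} →
                      A IsSubreductOf L → Embedding A L
subreduct⇒embedding {A = A} {L} (S , S≅A) = record
  { ⟦_⟧       = proj₁ ∘ from
  ; cong      = λ {x} {y} x≈y → reflect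
      (A.trans (to∘from x) (A.trans x≈y (A.sym (to∘from y))))
  ; injective = λ {x} {y} eq →
      A.trans (A.sym (to∘from x))
        (A.trans (S≅A.cong {from x} {from y} eq) (to∘from y))
  ; ∧-homo    = λ x y → reflect (A.trans (to∘from _) (A.sym
      (A.trans (S≅A.∧-homo (from x) (from y))
               (Algebra₂₂₀.∧-cong A (to∘from x) (to∘from y)))))
  ; ⇒-homo    = λ x y → reflect (A.trans (to∘from _) (A.sym
      (A.trans (S≅A.⇒-homo (from x) (from y))
               (Algebra₂₂₀.⇒-cong A (to∘from x) (to∘from y)))))
  ; ⊤-homo    = reflect (A.trans (to∘from _) (A.sym S≅A.⊤-homo))
  }
  where
  module A = IsEquivalence (Algebra₂₂₀.isEquivalence A)
  module S = Algebra₂₂₀ (subalgebra L S)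
  module S≅A = _≅_ S≅A

  from : Algebra₂₂₀.Carrier A → S.Carrier
  from x = proj₁ (proj₂ S≅A.bijective x)

  to∘from : ∀ x → Algebra₂₂₀._≈_ A S≅A.⟦ from x ⟧ x
  to∘from x = proj₂ (proj₂ S≅A.bijective x) (IsEquivalence.refl S.isEquivalence {from x})

  reflect : ∀ {s t} → Algebra₂₂₀._≈_ A S≅A.⟦ s ⟧ S≅A.⟦ t ⟧ → s S.≈ t
  reflect {s} {t} = proj₁ S≅A.bijective {s} {t}

-- Membership in the image stores a preimage, so the isomorphism onto `A` is a projection. The
-- carrier of `A` sits at level `b` so that the image has the level that `_IsSubreductOf_` demands.
embedding⇒subreduct : {A : Algebra₂₂₀ b ℓ₁} {L : SubresiduatedLattice b ℓ₂} →
                      Embedding A L → A IsSubreductOf L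
embedding⇒subreduct {A = A} {L} A↪L = image , record
  { ⟦_⟧       = λ (_ , x , _) → x
  ; cong      = λ {(_ , _ , x≈s)} {(_ , _ , y≈t)} s≈t →
      injective (trans x≈s (trans s≈t (sym y≈t)))
  ; bijective =
      (λ {(_ , _ , x≈s)} {(_ , _ , y≈t)} x≈y →
        trans (sym x≈s) (trans (cong x≈y) y≈t)) ,
      λ x → (⟦ x ⟧ , x , refl) ,
        λ {(_ , _ , y≈t)} t≈x → injective (trans y≈t t≈x)
  ; ∧-homo    = λ _ _ → A.refl
  ; ⇒-homo    = λ _ _ → A.refl
  -- `⊤-closed` reaches the top as `x ⇒ x` with `x` the image of `A.⊤`, so the stored preimage is
  -- `A.⊤ A.⇒ A.⊤`, which has to be identified with `A.⊤`.
  ; ⊤-homo    = injective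
      (trans (⇒-homo A.⊤ A.⊤) (trans (L.⇒-refl _) (sym ⊤-homo)))
  }
  where
  open Embedding A↪L
  module L = SubresiduatedLattice L
  open IsEquivalence L.isEquivalence using (refl; sym; trans)
  module A where
    open Algebra₂₂₀ A public
    open IsEquivalence isEquivalence public

  image : Subuniverse L _
  image = record
    { Member   = λ s → ∃ λ x → ⟦ x ⟧ L.≈ s
    ; resp     = λ s≈t (x , x≈s) → x , trans x≈s s≈t
    ; nonempty = ⟦ A.⊤ ⟧ , A.⊤ , refl
    ; ∧-closed = λ (x , x≈s) (y , y≈t) →
        x A.∧ y , trans (∧-homo x y) (L.∧-cong x≈s y≈t)
    ; ⇒-closed = λ (x , x≈s) (y , y≈t) →
        x A.⇒ y , trans (⇒-homo x y) (L.⇒-cong x≈s y≈t)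
    }

-- Transfer of the semilattice axioms to subreducts.

embedding⇒isSubresiduatedSemilattice :
  {A : Algebra₂₂₀ a ℓ₁} {L : SubresiduatedLattice b ℓ₂} →
  Embedding A L → IsSubresiduatedSemilattice A
embedding⇒isSubresiduatedSemilattice {A = A} {L} A↪L = record
  { isBoundedMeetSemilattice = record
      { isCommutativeMonoid = Mono.isCommutativeMonoid L-isCommutativeMonoid
      ; idem                = Mono.idem LP.∧-isMagma LP.∧-idem
      }
  ; SR1 = λ x y → injective (begin
      ⟦ (x A.∧ y) A.⇒ y ⟧        ≈⟨ ⇒-homo _ y ⟩
      ⟦ x A.∧ y ⟧ ⇒ ⟦ y ⟧        ≈⟨ ⇒-cong (∧-homo x y) refl ⟩
      (⟦ x ⟧ ∧ ⟦ y ⟧) ⇒ ⟦ y ⟧    ≈⟨ x∧y⇒y≈⊤ ⟦ x ⟧ ⟦ y ⟧ ⟩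
      ⊤                          ≈⟨ ⊤-homo ⟨
      ⟦ A.⊤ ⟧                    ∎)
  ; SR2 = λ x y z → reflects-≤ (⇒-homo x y)
      (trans (⇒-homo z _) (⇒-cong refl (⇒-homo x y)))
      (⇒-weaken ⟦ x ⟧ ⟦ y ⟧ ⟦ z ⟧)
  ; SR3 = λ x y → reflects-≤
      (trans (∧-homo x _) (∧-cong refl (⇒-homo x y))) refl
      (modusPonens ⟦ x ⟧ ⟦ y ⟧)
  ; SR4 = λ x y z → injective (begin
      ⟦ x A.⇒ y A.∧ z ⟧                    ≈⟨ ⇒-homo x _ ⟩
      ⟦ x ⟧ ⇒ ⟦ y A.∧ z ⟧                  ≈⟨ ⇒-cong refl (∧-homo y z) ⟩
      ⟦ x ⟧ ⇒ ⟦ y ⟧ ∧ ⟦ z ⟧                ≈⟨ ⇒-distribˡ-∧ ⟦ x ⟧ ⟦ y ⟧ ⟦ z ⟧ ⟩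
      (⟦ x ⟧ ⇒ ⟦ y ⟧) ∧ (⟦ x ⟧ ⇒ ⟦ z ⟧)    ≈⟨ ∧-cong (⇒-homo x y) (⇒-homo x z) ⟨
      ⟦ x A.⇒ y ⟧ ∧ ⟦ x A.⇒ z ⟧            ≈⟨ ∧-homo _ _ ⟨
      ⟦ (x A.⇒ y) A.∧ (x A.⇒ z) ⟧          ∎)
  }
  where
  module A = Algebra₂₂₀ A
  open Embedding A↪L
  open SubresiduatedLattice L
  open IsDistributiveLattice isDistributiveLattice
    using (isLattice; refl; sym; trans; ∧-comm)

  L-lattice : Lattice _ _
  L-lattice = record { isLattice = isLattice }

  L-setoid : Setoid _ _
  L-setoid = record { isEquivalence = isEquivalence }

  module LP = LatticeProperties L-lattice
  open ≈-Reasoning L-setoid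
  open Poset LP.poset using (antisym) renaming (trans to ≤-trans; reflexive to ≤-reflexive)

  L-isCommutativeMonoid : IsCommutativeMonoid _≈_ _∧_ ⊤
  L-isCommutativeMonoid = record
    { isMonoid = record
        { isSemigroup = LP.∧-isSemigroup
        ; identity    = (λ x → trans (∧-comm ⊤ x) (sym (maximum x))) , sym ∘ maximum
        }
    ; comm = ∧-comm
    }

  isMonoidMonomorphism : IsMonoidMonomorphism
    (record { _≈_ = A._≈_ ; _∙_ = A._∧_ ; ε = A.⊤ })
    (record { _≈_ = _≈_ ; _∙_ = _∧_ ; ε = ⊤ }) ⟦_⟧
  isMonoidMonomorphism = record
    { isMonoidHomomorphism = record
        { isMagmaHomomorphism = record
            { isRelHomomorphism = record { cong = cong }
            ; homo              = ∧-homo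
            }
        ; ε-homo = ⊤-homo
        }
    ; injective = injective
    }

  module Mono = MonoidMonomorphism isMonoidMonomorphism

  -- The natural order is an equation between meets, so an injective homomorphism reflects it. The
  -- parameters `u` and `v` let the images be rewritten into the shape of an axiom of `L`.
  reflects-≤ : ∀ {x y u v} → ⟦ x ⟧ ≈ u → ⟦ y ⟧ ≈ v → u ≤ v → x A.≤ y
  reflects-≤ {x} {y} {u} {v} x≈u y≈v u≤v = injective (begin
    ⟦ x ⟧          ≈⟨ x≈u ⟩
    u              ≈⟨ u≤v ⟩
    u ∧ v          ≈⟨ ∧-cong x≈u y≈v ⟨
    ⟦ x ⟧ ∧ ⟦ y ⟧  ≈⟨ ∧-homo x y ⟨
    ⟦ x A.∧ y ⟧    ∎)

  -- `(x ∧ y) ⇒ (x ∧ y)` is `⊤` and splits over its consequent into a meet with `(x ∧ y) ⇒ y`.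
  x∧y⇒y≈⊤ : ∀ x y → (x ∧ y) ⇒ y ≈ ⊤
  x∧y⇒y≈⊤ x y = antisym (maximum _) (≤-trans
    (≤-reflexive (trans (sym (⇒-refl (x ∧ y))) (⇒-distribˡ-∧ (x ∧ y) x y)))
    (NaturalOrder.x∙y≤y _≈_ _∧_ LP.∧-isSemilattice _ _))

-- Embedding a subresiduated semilattice into its join completion.

module JoinCompletion {A : Algebra₂₂₀ c ℓ} (SR : IsSubresiduatedSemilattice A) where
  open Algebra₂₂₀ A
  open IsSubresiduatedSemilattice SR
  open IsBoundedMeetSemilattice _≈_ isBoundedMeetSemilattice
    using (isMeetSemilattice; identityʳ)

  semilattice : Semilattice c ℓ
  semilattice = record { isSemilattice = isMeetSemilattice }

  open SemilatticeProperties semilattice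
    using (poset; ∧-orderTheoreticMeetSemilattice)
  open Order.MeetSemilattice ∧-orderTheoreticMeetSemilattice
    using (module Eq; antisym; x∧y≤x; x∧y≤y; ∧-greatest)
    renaming (refl to ≤-refl; trans to ≤-trans; reflexive to ≤-reflexive)
  open MeetSemilatticeProperties ∧-orderTheoreticMeetSemilattice using (∧-monotonic)

  x≤⊤ : ∀ x → x ≤ ⊤
  x≤⊤ x = Eq.sym (identityʳ x)

  ⇒-refl : ∀ x → x ⇒ x ≈ ⊤
  -- In the natural order `≤-refl` is the equation `x ≈ x ∧ x`, which produces the antecedent of
  -- `SR1`.
  ⇒-refl x = Eq.trans (⇒-cong ≤-refl Eq.refl) (SR1 x x)

  ⇒-monoʳ : ∀ x {y z} → y ≤ z → x ⇒ y ≤ x ⇒ z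
  ⇒-monoʳ x {y} {z} y≤z = Eq.trans (⇒-cong Eq.refl y≤z) (SR4 x y z)

  -- The reverse inequality always holds by `SR3`, so the opens are the fixed points of `⊤ ⇒_`; by
  -- `SR2` they are, up to `_≈_`, exactly the values of `_⇒_`.
  Open : Pred Carrier ℓ
  Open d = d ≤ ⊤ ⇒ d

  ⊤-open : Open ⊤
  ⊤-open = ≤-reflexive (Eq.sym (⇒-refl ⊤))

  ∧-open : ∀ {d e} → Open d → Open e → Open (d ∧ e)
  ∧-open d-open e-open =
    ≤-trans (∧-monotonic d-open e-open) (≤-reflexive (Eq.sym (SR4 ⊤ _ _)))

  ⇒-open : ∀ x y → Open (x ⇒ y)
  ⇒-open x y = SR2 x y ⊤

  open≤⇒ : ∀ {d} x → Open d → d ≤ x ⇒ d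
  open≤⇒ {d} x d-open = begin
    d            ≤⟨ d-open ⟩
    ⊤ ⇒ d        ≤⟨ SR2 ⊤ d x ⟩
    x ⇒ (⊤ ⇒ d)  ≤⟨ ⇒-monoʳ x ⊤⇒d≤d ⟩
    x ⇒ d        ∎
    where
    open ≤-Reasoning poset
    ⊤⇒d≤d : ⊤ ⇒ d ≤ d
    ⊤⇒d≤d = ≤-trans (∧-greatest (x≤⊤ _) ≤-refl) (SR3 ⊤ d)

  -- `d` lies below both `x ⇒ x`, which is `⊤`, and `x ⇒ d`; `SR4` merges the two into `x ⇒ x ∧ d`.
  ⇒-largest : ∀ {d x y} → Open d → x ∧ d ≤ y → d ≤ x ⇒ y
  ⇒-largest {d} {x} {y} d-open x∧d≤y = begin
    d                  ≤⟨ ∧-greatest (x≤⊤ d) (open≤⇒ x d-open) ⟩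
    ⊤ ∧ (x ⇒ d)        ≈⟨ ∧-cong (⇒-refl x) Eq.refl ⟨
    (x ⇒ x) ∧ (x ⇒ d)  ≈⟨ SR4 x x d ⟨
    x ⇒ x ∧ d          ≤⟨ ⇒-monoʳ x x∧d≤y ⟩
    x ⇒ y              ∎
    where open ≤-Reasoning poset

  ⇒-eval : ∀ {d x y} → d ≤ x ⇒ y → x ∧ d ≤ y
  ⇒-eval {x = x} {y} d≤x⇒y = ≤-trans (∧-monotonic ≤-refl d≤x⇒y) (SR3 x y)

  -- Finitely generated down-sets and their implication.

  ↓_ : List Carrier → Pred Carrier (c ⊔ ℓ)
  (↓ X) a = Any (a ≤_) X

  infixr 7 _⊓_
  _⊓_ : Op₂ (List Carrier)
  _⊓_ = cartesianProductWith _∧_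

  infixr 5 _⟹_
  _⟹_ : Op₂ (List Carrier)
  X ⟹ Y = foldr (λ x Z → map (x ⇒_) Y ⊓ Z) [ ⊤ ] X

  ↓-lower : ∀ {X a b} → a ≤ b → b ∈ ↓ X → a ∈ ↓ X
  ↓-lower a≤b = Any.map (≤-trans a≤b)

  entries∈↓ : ∀ X → All (_∈ ↓ X) X
  entries∈↓ X = All.tabulate (Any.map (≤-reflexive ∘ Eq.reflexive))

  ↓-⊓⁺ : ∀ {X Y} → ↓ X ∩ ↓ Y ⊆ ↓ (X ⊓ Y)
  ↓-⊓⁺ (a∈X , a∈Y) = Any.cartesianProductWith⁺ _∧_ ∧-greatest a∈X a∈Y

  ↓-⊓⁻ : ∀ X Y → ↓ (X ⊓ Y) ⊆ ↓ X ∩ ↓ Y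
  ↓-⊓⁻ X Y = Any.cartesianProductWith⁻ _∧_
    (λ a≤x∧y → ≤-trans a≤x∧y (x∧y≤x _ _) , ≤-trans a≤x∧y (x∧y≤y _ _)) X Y

  -- Lists are compared by the down-sets they generate, so injectivity is immediate and the
  -- distributive lattice laws pull back from the lattice of all predicates on `Carrier`.
  ↓-isLatticeMonomorphism : IsLatticeMonomorphism
    (record { _≈_ = λ X Y → ↓ X ≐ ↓ Y ; _∧_ = _⊓_ ; _∨_ = _++_ })
    (record { _≈_ = _≐_ ; _∧_ = _∩_ ; _∨_ = _∪_ }) ↓_
  ↓-isLatticeMonomorphism = record
    { isLatticeHomomorphism = record
        { isRelHomomorphism = record { cong = id }
        ; ∧-homo = λ X Y → ↓-⊓⁻ X Y , ↓-⊓⁺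
        ; ∨-homo = λ X Y → Any.++⁻ X , [ Any.++⁺ˡ , Any.++⁺ʳ X ]′
        }
    ; injective = id
    }

  distributiveLattice : DistributiveLattice c (c ⊔ ℓ)
  distributiveLattice = record
    { isDistributiveLattice =
        LatticeMonomorphism.isDistributiveLattice ↓-isLatticeMonomorphism
          (∪-∩-isDistributiveLattice Carrier (c ⊔ ℓ))
    }

  open NaturalOrder (DistributiveLattice._≈_ distributiveLattice) _⊓_
    using () renaming (_≤_ to _⊑_)

  ⊆⇒⊑ : ∀ {X Y} → ↓ X ⊆ ↓ Y → X ⊑ Y
  ⊆⇒⊑ {X} {Y} X⊆Y = (λ a∈X → ↓-⊓⁺ (a∈X , X⊆Y a∈X)) , proj₁ ∘ ↓-⊓⁻ X Y

  ⊑⇒⊆ : ∀ {X Y} → X ⊑ Y → ↓ X ⊆ ↓ Y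
  ⊑⇒⊆ {X} {Y} X⊑Y = proj₂ ∘ ↓-⊓⁻ X Y ∘ proj₁ X⊑Y

  -- An `a` in the left side lies below some entry `x` of `X`. The factor of `X ⟹ Y` belonging to
  -- that `x` supplies a `y` with `a ≤ x ⇒ y`, whence `a ≤ x ∧ a ≤ y`.
  ⟹-eval : ∀ X Y → X ⊓ (X ⟹ Y) ⊑ Y
  ⟹-eval X Y = ⊆⇒⊑ λ a∈ → let a∈X , a∈X⟹Y = ↓-⊓⁻ X (X ⟹ Y) a∈ in go X a∈X a∈X⟹Y
    where
    go : ∀ X {a} → a ∈ ↓ X → a ∈ ↓ (X ⟹ Y) → a ∈ ↓ Y
    go (x ∷ X) a∈x∷X a∈ with a∈x∷X | ↓-⊓⁻ (map (x ⇒_) Y) (X ⟹ Y) a∈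
    ... | here a≤x  | a∈x⇒Y , _     = Any.map
      (λ a≤x⇒y → ≤-trans (∧-greatest a≤x ≤-refl) (⇒-eval a≤x⇒y)) (Any.map⁻ a∈x⇒Y)
    ... | there a∈X | _     , a∈X⟹Y = go X a∈X a∈X⟹Y

  -- Each `x ∧ d` lies below a single entry `y` of `Y`, which may vary with `x`, so the adjunction
  -- in `A` gives `d ≤ x ⇒ y` factor by factor.
  ∈-⟹ : ∀ {d X Y} → Open d → All (λ x → x ∧ d ∈ ↓ Y) X → d ∈ ↓ (X ⟹ Y)
  ∈-⟹ {d} d-open [] = here (x≤⊤ d)
  ∈-⟹ d-open (x∧d∈Y ∷ rest) =
    ↓-⊓⁺ (Any.map⁺ (Any.map (⇒-largest d-open) x∧d∈Y) , ∈-⟹ d-open rest)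

  ⊓-open : ∀ {D E} → All Open D → All Open E → All Open (D ⊓ E)
  ⊓-open []                E-open = []
  ⊓-open (d-open ∷ D-open) E-open =
    All.++⁺ (All.map⁺ (All.map (∧-open d-open) E-open)) (⊓-open D-open E-open)

  ⟹-open : ∀ X Y → All Open (X ⟹ Y)
  ⟹-open []      Y = ⊤-open ∷ []
  ⟹-open (x ∷ X) Y = ⊓-open (All.map⁺ (All.universal (⇒-open x) Y)) (⟹-open X Y)

  ⟹-largest : ∀ {D} X Y → All Open D → X ⊓ D ⊑ Y → D ⊑ X ⟹ Y
  -- An `a` in `↓ D` need not be open, so the claim is proved for the entries `d` of `D` and passed
  -- down to `a`. Every `x ∧ d` is in `↓ (X ⊓ D)`, hence in `↓ Y`.
  ⟹-largest {D} X Y D-open X⊓D⊑Y = ⊆⇒⊑ λ a∈D →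
    All.lookupWith (λ d∈X⟹Y a≤d → ↓-lower a≤d d∈X⟹Y)
      (All.zipWith
        (λ (d-open , d∈D) → ∈-⟹ d-open (All.map
          (λ x∈X → ⊑⇒⊆ {X ⊓ D} X⊓D⊑Y
            (↓-⊓⁺ (↓-lower (x∧y≤x _ _) x∈X , ↓-lower (x∧y≤y _ _) d∈D)))
          (entries∈↓ X)))
        (D-open , entries∈↓ D))
      a∈D

  subresiduatedLattice : SubresiduatedLattice c (c ⊔ ℓ)
  subresiduatedLattice = largestOpens⇒subresiduatedLattice distributiveLattice
    -- The bottom is the empty down-set, a new element even if `A` has a least one.
    [] [ ⊤ ] (λ Y → ⊆⇒⊑ {Y = Y} λ ()) (λ X → ⊆⇒⊑ λ {a} _ → here (x≤⊤ a))
    (All Open) _⟹_ (⊤-open ∷ []) ⊓-open ⟹-open ⟹-eval ⟹-largest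

  embedding : Embedding A subresiduatedLattice
  embedding = record
    { ⟦_⟧       = [_]
    ; cong      = singleton-cong
    ; injective = λ (x⊆y , y⊆x) →
        antisym (singleton⁻ (x⊆y (here ≤-refl))) (singleton⁻ (y⊆x (here ≤-refl)))
    ; ∧-homo    = λ _ _ → id , id
    -- `[ x ] ⟹ [ y ]` computes to `[ (x ⇒ y) ∧ ⊤ ]`, the `⊤` being the start value of the fold.
    ; ⇒-homo    = λ x y → singleton-cong (Eq.sym (identityʳ (x ⇒ y)))
    ; ⊤-homo    = id , id
    }
    where
    singleton⁻ : ∀ {x y} → x ∈ ↓ [ y ] → x ≤ y
    singleton⁻ (here x≤y) = x≤y

    singleton-cong : ∀ {x y} → x ≈ y → ↓ [ x ] ≐ ↓ [ y ]
    singleton-cong x≈y =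
      (λ { (here a≤x) → here (≤-trans a≤x (≤-reflexive x≈y)) }) ,
      (λ { (here a≤y) → here (≤-trans a≤y (≤-reflexive (Eq.sym x≈y))) })

theorem4p10 : ∀ {c ℓ} (A : Algebra₂₂₀ c ℓ) →
    IsSubresiduatedSemilattice A ⇔ (∃ λ (L : SubresiduatedLattice c (c ⊔ ℓ)) → A IsSubreductOf L)
theorem4p10 A = mk⇔
  (λ SR → JoinCompletion.subresiduatedLattice SR ,
    embedding⇒subreduct (JoinCompletion.embedding SR))
  (λ (_ , A≤L) → embedding⇒isSubresiduatedSemilattice (subreduct⇒embedding A≤L))
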